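{- Let $G$ be an abelian group, and let $A,B\subseteq G$ be finite and nonempty. Then either $$|A+_1B|+|A+_2B|\geq 2|A|+2|B|-4,$$ or there exists a coset $x+H\subseteq A+_2B$ (with $x\in G$ and $H$ a subgroup of $G$) with $|H|\geq 3$.
   Context: $G$ is written additively. For finite nonempty subsets $A,B\subseteq G$ and $g\in G$, $r_{A,B}(g)=|(g-B)\cap A|$ is the number of representations $g=a+b$ with $a\in A$, $b\in B$. For an integer $i\geq 1$, $A+_iB:=\{g\in G\mid r_{A,B}(g)\geq i\}$ (so $A+_1B$ is the sumset $A+B$).
   Formalization: "Nonempty" is replaced by |A|, |B| ≥ 2: the claim is false when |A|=1 and |B|≥3 (e.g. A={0}, B={0,1,5} in the integers) or vice versa; only the trivial sizes (1,1), (1,2), (2,1) are lost. Equality in G is assumed decidable. -}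

module Defs where

open import Level using (_⊔_)
open import Algebra.Bundles using (AbelianGroup)
open import Data.List.Base using (List; []; _∷_; length; map; filter; deduplicate; cartesianProductWith)
open import Data.List.Properties using (filter-≐)
open import Data.List.Relation.Unary.Any using (here; there)
open import Data.Nat.Base using (ℕ; _≤_; NonZero; >-nonZero⁻¹)
import Data.Nat.Properties as ℕ
open import Data.Product.Base using (_,_; proj₂; ∃-syntax)
open import Function.Bundles using (_⇔_; mk⇔)
open import Relation.Binary.Bundles using (DecSetoid)
open import Relation.Binary.Definitions using (Decidable)
open import Relation.Binary.PropositionalEquality as ≡ using (_≡_)

-- Cardinalities of finite subsets, such as sumsets, are only computable when
-- equality of G is decidable (which classically always holds).
module PopularSums {c ℓ} (G : AbelianGroup c ℓ)
                   (_≟_ : Decidable (AbelianGroup._≈_ G)) where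

  open AbelianGroup G public
    using (Carrier; _≈_; setoid; _-_)
    renaming (_∙_ to _+_; ε to 0#; _⁻¹ to -_)

  open AbelianGroup G using (isEquivalence; refl; sym; trans; assoc; comm; identityʳ; inverseˡ; ∙-cong; ∙-congʳ; ∙-congˡ)

  decSetoid : DecSetoid c ℓ
  decSetoid = record
    { isDecEquivalence = record { isEquivalence = isEquivalence ; _≟_ = _≟_ } }

  import Data.List.Membership.DecSetoid decSetoid as List∈

  open import Data.List.Membership.Setoid.Properties
    using (∈-resp-≈; ∈-filter⁺; ∈-filter⁻; ∈-map⁻; ∈-deduplicate⁺; ∈-deduplicate⁻; ∈-cartesianProductWith⁺)
  open import Data.List.Relation.Unary.Unique.DecSetoid decSetoid using (Unique)
  open import Data.List.Relation.Unary.Unique.DecSetoid.Properties using (deduplicate-!)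
  open import Data.List.Relation.Unary.Unique.Setoid.Properties using (filter⁺)

  record FinSubset : Set (c ⊔ ℓ) where
    field
      elements : List Carrier
      unique   : Unique elements

  open FinSubset public

  infix 4 _∈_
  _∈_ : Carrier → FinSubset → Set (c ⊔ ℓ)
  g ∈ A = g List∈.∈ elements A

  ∣_∣ : FinSubset → ℕ
  ∣ A ∣ = length (elements A)

  infixl 6 _-ˢ_
  _-ˢ_ : Carrier → FinSubset → List Carrier
  g -ˢ B = map (λ b → g - b) (elements B)

  -- The filtered list enumerates (g - B) ∩ A without repetition.
  r : FinSubset → FinSubset → Carrier → ℕ
  r A B g = length (filter (List∈._∈? (g -ˢ B)) (elements A))

  -- For i ≥ 1 every g with r A B g ≥ i is some a + b, so it suffices to
  -- filter the list of all sums; ∈-+⟨⟩ below confirms membership.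
  infixl 6 _+⟨_⟩_
  _+⟨_⟩_ : FinSubset → (i : ℕ) → .{{NonZero i}} → FinSubset → FinSubset
  A +⟨ i ⟩ B = record
    { elements = filter (λ g → i ℕ.≤? r A B g) (deduplicate _≟_ sums)
    ; unique   = filter⁺ setoid _ (deduplicate-! decSetoid sums)
    }
    where sums = cartesianProductWith _+_ (elements A) (elements B)

  -- Only finite H are needed: a subgroup with a coset inside a finite set is
  -- itself finite.
  record IsSubgroup (H : FinSubset) : Set (c ⊔ ℓ) where
    field
      0#-closed  : 0# ∈ H
      +-closed   : ∀ {x y} → x ∈ H → y ∈ H → x + y ∈ H
      neg-closed : ∀ {x} → x ∈ H → - x ∈ H

  infix 4 _+ᶜ_⊆_
  _+ᶜ_⊆_ : Carrier → FinSubset → FinSubset → Set (c ⊔ ℓ)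
  x +ᶜ H ⊆ S = ∀ {h} → h ∈ H → x + h ∈ S

  private
    shift : ∀ {g h} (bs : List Carrier) {a} → g ≈ h →
            a List∈.∈ map (λ b → g - b) bs → a List∈.∈ map (λ b → h - b) bs
    shift (b ∷ bs) g≈h (here a≈)  = here (trans a≈ (∙-congʳ g≈h))
    shift (b ∷ bs) g≈h (there a∈) = there (shift bs g≈h a∈)

    r-cong : ∀ A B {g h} → g ≈ h → r A B g ≡ r A B h
    r-cong A B g≈h = ≡.cong length
      (filter-≐ _ _ (shift (elements B) g≈h , shift (elements B) (sym g≈h)) (elements A))

    nonempty : (xs : List Carrier) → 1 ≤ length xs → ∃[ x ] (x List∈.∈ xs)
    nonempty (x ∷ xs) _ = x , here refl

    r>0⇒sum : ∀ A B g → 1 ≤ r A B g →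
              g List∈.∈ cartesianProductWith _+_ (elements A) (elements B)
    r>0⇒sum A B g 1≤r =
      let a , a∈ = nonempty _ 1≤r
          a∈A , a∈g-B = ∈-filter⁻ setoid (List∈._∈? (g -ˢ B)) (∈-resp-≈ setoid) {xs = elements A} a∈
          b , b∈B , a≈g-b = ∈-map⁻ setoid setoid a∈g-B
          a+b≈g = trans (∙-congʳ a≈g-b)
                 (trans (assoc g (- b) b)
                 (trans (∙-congˡ (inverseˡ b)) (identityʳ g)))
      in ∈-resp-≈ setoid a+b≈g (∈-cartesianProductWith⁺ setoid setoid setoid ∙-cong a∈A b∈B)

  ∈-+⟨⟩ : ∀ A B i .{{_ : NonZero i}} g → g ∈ (A +⟨ i ⟩ B) ⇔ i ≤ r A B g
  ∈-+⟨⟩ A B i g = mk⇔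
    (λ g∈ → proj₂ (∈-filter⁻ setoid P? resp {xs = deduplicate _≟_ sums} g∈))
    (λ i≤r → ∈-filter⁺ setoid P? resp
      (∈-deduplicate⁺ setoid _≟_ (λ z≈y x≈y → trans x≈y (sym z≈y))
        (r>0⇒sum A B g (ℕ.≤-trans (>-nonZero⁻¹ i) i≤r)))
      i≤r)
    where
    sums = cartesianProductWith _+_ (elements A) (elements B)
    P? = λ h → i ℕ.≤? r A B h
    resp : ∀ {x y} → x ≈ y → i ≤ r A B x → i ≤ r A B y
    resp x≈y = ≡.subst (i ≤_) (r-cong A B x≈y)

{-# OPTIONS --safe #-}
module Submission where

-- Induction on |A| + 2|B|; the cases |A| = 2 and |B| = 2 are inclusion–exclusion
-- for two translates. A Dyson transform A ∪ (B + e), B ∩ (A - e) preserves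
-- |A| + |B| and does not increase any r(g), so it may be applied whenever
-- 2 ≤ |B ∩ (A - e)| < |B|. If no e = a - b is of this kind, each pair (a , b) is
-- Good (a - b + B ⊆ A) or Single (a - b + B meets A in a only, i.e. the row a + B
-- and the column A + b meet only in a + b).
--   If all pairs with some a are Single, the sums a + B are uniquely represented,
-- and a can be removed. If all pairs are Good, A is a union of cosets of ⟨B - B⟩.
-- Otherwise a Single pair gives a row and a column with |A| + |B| - 1 sums in
-- total, which suffices if all sums lie in A +₂ B. If instead a + b has no other
-- representation, then a + b is the only such sum in row a, and for y , z ≠ b in B
-- the sums missing from A +₂ B in column y are compensated in A +₁ B by those of
-- column z, after choosing y to have at most as many of them as z.

open import Defs
open import Level using (Level; _⊔_)
open import Algebra.Bundles using (AbelianGroup)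
open import Data.Empty using (⊥-elim)
open import Data.List.Base using (List; []; _∷_; _++_; length; map; filter)
open import Data.List.Properties using (length-map; length-++; filter-notAll)
open import Data.List.Relation.Unary.All using ([]; _∷_)
open import Data.List.Relation.Unary.All.Properties using (¬Any⇒All¬; All¬⇒¬Any)
open import Data.List.Relation.Unary.AllPairs using ([]; _∷_)
open import Data.List.Relation.Unary.Any as Any using (here; there)
open import Data.Nat.Base as ℕ using (ℕ; zero; suc; z≤n; s≤s; s≤s⁻¹; _<_; _+_; _*_; _∸_; _≤_; _≥_)
import Data.Nat.Properties as ℕ
open import Data.Nat.Tactic.RingSolver using (solve-∀)
open import Data.Product.Base using (_×_; _,_; proj₁; proj₂; ∃-syntax; ∃₂)
open import Data.Sum.Base as Sum using (_⊎_; inj₁; inj₂; [_,_]′)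
open import Function.Base using (_∘_; id)
open import Function.Bundles using (module Equivalence)
open import Relation.Binary.Definitions using (Decidable)
open import Relation.Binary.PropositionalEquality as ≡ using (_≡_)
open import Relation.Nullary.Decidable using (Dec; yes; no; ¬?; _→-dec_)
open import Relation.Nullary.Decidable.Core using (decidable-stable)
open import Relation.Nullary.Negation using (¬_; contradiction)
open import Relation.Unary using (Pred) renaming (Decidable to Decidable₁)

-- Counting in lists without repetition.

length-filter-complement : ∀ {a p} {X : Set a} {P : Pred X p} (P? : Decidable₁ P) xs →
  length (filter P? xs) + length (filter (λ x → ¬? (P? x)) xs) ≡ length xs
length-filter-complement P? [] = ≡.refl
length-filter-complement P? (x ∷ xs) with P? x
... | yes _ = ≡.cong suc (length-filter-complement P? xs)
... | no  _ = ≡.trans (ℕ.+-suc _ _) (≡.cong suc (length-filter-complement P? xs))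

module _ {c ℓ} (G : AbelianGroup c ℓ) (_≟_ : Decidable (AbelianGroup._≈_ G)) where

  open PopularSums G _≟_ renaming (_+_ to _∙_)
  open AbelianGroup G
    using (refl; sym; trans; assoc; identityʳ; ∙-cong; ∙-congˡ; ∙-congʳ; ⁻¹-cong; commutativeMonoid)
  open import Algebra.Properties.AbelianGroup G
    using (∙-cancelˡ; ∙-cancelʳ; x≈z//y; //-rightDividesˡ; //-rightDividesʳ; xyx⁻¹≈y)
  open import Algebra.Solver.CommutativeMonoid commutativeMonoid using (solve; _⊜_) renaming (_⊕_ to _:∙_)
  open import Data.List.Membership.DecSetoid decSetoid using (_∈?_) renaming (_∈_ to _∈ₗ_)
  open import Data.List.Membership.Setoid.Properties
    using (∈-resp-≈; ∈-filter⁺; ∈-filter⁻; ∈-map⁺; ∈-map⁻; ∈-++⁻)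
  open import Data.List.Relation.Unary.Unique.DecSetoid decSetoid using (Unique)
  open import Data.List.Relation.Unary.Unique.Setoid.Properties using (map⁺; filter⁺; ++⁺)

  infix 4 _≉_
  _≉_ : Carrier → Carrier → Set ℓ
  x ≉ y = ¬ (x ≈ y)

  -- Induction on `xs`: deleting its head x from `ys` shortens `ys`, since x occurs there, and loses
  -- no entry of the tail, since x does not recur.
  Unique⇒length≤ : ∀ {xs ys} → Unique xs → (∀ {x} → x ∈ₗ xs → x ∈ₗ ys) → length xs ≤ length ys
  Unique⇒length≤ {[]} _ _ = z≤n
  Unique⇒length≤ {x ∷ xs} {ys} (x∉xs ∷ xs!) xs⊆ys = ℕ.≤-trans
    (s≤s (Unique⇒length≤ xs! (λ {y} y∈xs →
      ∈-filter⁺ setoid ≉x? (λ y≈z y≉x z≈x → y≉x (trans y≈z z≈x)) (xs⊆ys (there y∈xs))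
        (λ y≈x → All¬⇒¬Any x∉xs (∈-resp-≈ setoid y≈x y∈xs)))))
    (filter-notAll ≉x? ys (Any.map (λ x≈y y≉x → y≉x (sym x≈y)) (xs⊆ys (here refl))))
    where
    ≉x? : ∀ y → Dec (y ≉ x)
    ≉x? y = ¬? (y ≟ x)

  two-elements : ∀ {xs} → Unique xs → 2 ≤ length xs →
    ∃₂ λ x y → x ∈ₗ xs × y ∈ₗ xs × x ≉ y
  two-elements {_ ∷ []} _ (s≤s ())
  two-elements {x ∷ y ∷ _} ((x≉y ∷ _) ∷ _) _ = x , y , here refl , there (here refl) , x≉y

  pair-unique : ∀ {x y} → x ≉ y → Unique (x ∷ y ∷ [])
  pair-unique x≉y = (x≉y ∷ []) ∷ [] ∷ []

  pair-⊆ : ∀ {x y zs} → x ∈ₗ zs → y ∈ₗ zs → ∀ {v} → v ∈ₗ x ∷ y ∷ [] → v ∈ₗ zs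
  pair-⊆ x∈ y∈ (here v≈x)         = ∈-resp-≈ setoid (sym v≈x) x∈
  pair-⊆ x∈ y∈ (there (here v≈y)) = ∈-resp-≈ setoid (sym v≈y) y∈

  disjoint-length : ∀ {xs ys zs} → Unique xs → Unique ys →
    (∀ {v} → v ∈ₗ xs → v ∈ₗ zs) → (∀ {v} → v ∈ₗ ys → v ∈ₗ zs) →
    (∀ {v} → v ∈ₗ xs → ¬ v ∈ₗ ys) → length xs + length ys ≤ length zs
  disjoint-length {xs} xs! ys! xs⊆ ys⊆ xs#ys = ≡.subst (_≤ _) (length-++ xs)
    (Unique⇒length≤ (++⁺ setoid xs! ys! (λ (v∈xs , v∈ys) → xs#ys v∈xs v∈ys))
      (λ v∈ → [ xs⊆ , ys⊆ ]′ (∈-++⁻ setoid xs v∈)))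

  -- Inclusion-exclusion: the part of `ys` outside `xs` fits beside `xs` in `us`, and the part
  -- inside `xs` fits in `is`.
  union-intersection-length : ∀ {xs ys us is} → Unique xs → Unique ys →
    (∀ {v} → v ∈ₗ xs → v ∈ₗ us) → (∀ {v} → v ∈ₗ ys → v ∈ₗ us) →
    (∀ {v} → v ∈ₗ xs → v ∈ₗ ys → v ∈ₗ is) → length xs + length ys ≤ length us + length is
  union-intersection-length {xs} {ys} {us} {is} xs! ys! xs⊆ ys⊆ ∩⊆ = begin
    length xs + length ys                       ≡⟨ ≡.cong (length xs +_) (length-filter-complement (_∈? xs) ys) ⟨
    length xs + (length inner + length outer)   ≡⟨ swap (length xs) (length inner) (length outer) ⟩
    (length xs + length outer) + length inner   ≤⟨ ℕ.+-mono-≤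
      (disjoint-length xs! (filter⁺ setoid _ ys!) xs⊆ (ys⊆ ∘ proj₁ ∘ outer⁻)
        (λ v∈xs v∈ → proj₂ (outer⁻ v∈) v∈xs))
      (Unique⇒length≤ (filter⁺ setoid _ ys!) (λ v∈ →
        let v∈ys , v∈xs = ∈-filter⁻ setoid (_∈? xs) (∈-resp-≈ setoid) {xs = ys} v∈ in ∩⊆ v∈xs v∈ys)) ⟩
    length us + length is                       ∎
    where
    open ℕ.≤-Reasoning
    inner outer : List Carrier
    inner = filter (_∈? xs) ys
    outer = filter (λ y → ¬? (y ∈? xs)) ys
    outer⁻ : ∀ {v} → v ∈ₗ outer → v ∈ₗ ys × ¬ v ∈ₗ xs
    outer⁻ = ∈-filter⁻ setoid (λ y → ¬? (y ∈? xs)) (λ x≈y x∉ y∈ → x∉ (∈-resp-≈ setoid (sym x≈y) y∈)) {xs = ys}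
    swap : ∀ x i o → x + (i + o) ≡ (x + o) + i
    swap = solve-∀

  -- Finite search.

  -- Membership is up to `≈`, so Q, known at the listed entries, has to be transported to every
  -- element equal to one of them.
  search : ∀ {p q} {P : Carrier → Set p} {Q : Carrier → Set q} →
    (∀ {x y} → x ≈ y → Q x → Q y) → ∀ xs → (∀ {x} → x ∈ₗ xs → P x ⊎ Q x) →
    (∃[ x ] (x ∈ₗ xs × P x)) ⊎ (∀ {x} → x ∈ₗ xs → Q x)
  search resp [] _ = inj₂ λ ()
  search resp (x ∷ xs) PQ with PQ (here refl) | search resp xs (PQ ∘ there)
  ... | inj₁ Px | _                     = inj₁ (x , here refl , Px)
  ... | inj₂ _  | inj₁ (y , y∈xs , Py) = inj₁ (y , there y∈xs , Py)
  ... | inj₂ Qx | inj₂ Qxs              = inj₂ λ { (here y≈x) → resp (sym y≈x) Qx ; (there y∈) → Qxs y∈ }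

  search₂ : ∀ {p q} {P : Carrier → Carrier → Set p} {Q : Carrier → Carrier → Set q} →
    (∀ {x x′ y y′} → x ≈ x′ → y ≈ y′ → Q x y → Q x′ y′) → ∀ xs ys →
    (∀ {x y} → x ∈ₗ xs → y ∈ₗ ys → P x y ⊎ Q x y) →
    (∃₂ λ x y → x ∈ₗ xs × y ∈ₗ ys × P x y) ⊎ (∀ {x y} → x ∈ₗ xs → y ∈ₗ ys → Q x y)
  search₂ {Q = Q} resp xs ys PQ
    with search {Q = λ x → ∀ {y} → y ∈ₗ ys → Q x y}
           (λ x≈x′ Qx y∈ → resp x≈x′ refl (Qx y∈)) xs (λ x∈ → search (resp refl) ys (PQ x∈))
  ... | inj₁ (x , x∈ , y , y∈ , Pxy) = inj₁ (x , y , x∈ , y∈ , Pxy)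
  ... | inj₂ Qs = inj₂ λ x∈ y∈ → Qs x∈ y∈

  -- In this order `search` yields either a counterexample or the universal statement.
  ¬P⊎P : ∀ {p} {P : Set p} → Dec P → (¬ P) ⊎ P
  ¬P⊎P (yes p) = inj₂ p
  ¬P⊎P (no ¬p) = inj₁ ¬p

  -- Removing an element; rows and columns of the addition table.

  infixl 6 _∖_
  _∖_ : FinSubset → Carrier → FinSubset
  A ∖ b = record
    { elements = filter (λ x → ¬? (x ≟ b)) (elements A)
    ; unique   = filter⁺ setoid _ (unique A)
    }

  ≉-resp : ∀ {b x y} → x ≈ y → x ≉ b → y ≉ b
  ≉-resp x≈y x≉b y≈b = x≉b (trans x≈y y≈b)

  ∈-∖⁻ : ∀ A {b x} → x ∈ A ∖ b → x ∈ A × x ≉ b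
  ∈-∖⁻ A {b} = ∈-filter⁻ setoid (λ x → ¬? (x ≟ b)) ≉-resp {xs = elements A}

  ∈-∖⁺ : ∀ A {b x} → x ∈ A → x ≉ b → x ∈ A ∖ b
  ∈-∖⁺ A {b} = ∈-filter⁺ setoid (λ x → ¬? (x ≟ b)) ≉-resp {xs = elements A}

  ∣A∣≤1+∣A∖b∣ : ∀ A b → ∣ A ∣ ≤ suc ∣ A ∖ b ∣
  ∣A∣≤1+∣A∖b∣ A b = Unique⇒length≤ (unique A) member
    where
    member : ∀ {x} → x ∈ A → x ∈ₗ b ∷ elements (A ∖ b)
    member {x} x∈A with x ≟ b
    ... | yes x≈b = here x≈b
    ... | no  x≉b = there (∈-∖⁺ A x∈A x≉b)

  ∣A∖b∣<∣A∣ : ∀ A {b} → b ∈ A → ∣ A ∖ b ∣ < ∣ A ∣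
  ∣A∖b∣<∣A∣ A b∈A = filter-notAll _ (elements A) (Any.map (λ b≈x x≉b → x≉b (sym b≈x)) b∈A)

  row : Carrier → List Carrier → List Carrier
  row a ys = map (a ∙_) ys

  column : Carrier → List Carrier → List Carrier
  column b xs = map (_∙ b) xs

  row-unique : ∀ a {ys} → Unique ys → Unique (row a ys)
  row-unique a = map⁺ setoid setoid (∙-cancelˡ a _ _)

  column-unique : ∀ b {xs} → Unique xs → Unique (column b xs)
  column-unique b = map⁺ setoid setoid (∙-cancelʳ b _ _)

  ∈-row⁻ : ∀ {a ys v} → v ∈ₗ row a ys → ∃[ y ] (y ∈ₗ ys × v ≈ a ∙ y)
  ∈-row⁻ = ∈-map⁻ setoid setoid

  ∈-column⁻ : ∀ {b xs v} → v ∈ₗ column b xs → ∃[ x ] (x ∈ₗ xs × v ≈ x ∙ b)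
  ∈-column⁻ = ∈-map⁻ setoid setoid

  -- Representations of sums.

  module Sums (A B : FinSubset) where

    S₁ S₂ : FinSubset
    S₁ = A +⟨ 1 ⟩ B
    S₂ = A +⟨ 2 ⟩ B

    record Rep (g : Carrier) : Set (c ⊔ ℓ) where
      constructor rep
      field
        {a b} : Carrier
        a∈A   : a ∈ A
        b∈B   : b ∈ B
        a∙b≈g : a ∙ b ≈ g

    -- The list whose length is `r A B g`. It holds first summands only, since these determine the
    -- second ones; distinct representations are therefore told apart by their first summands.
    reps : Carrier → List Carrier
    reps g = filter (_∈? (g -ˢ B)) (elements A)

    ∈-reps⁺ : ∀ {g} (ρ : Rep g) → Rep.a ρ ∈ₗ reps g
    ∈-reps⁺ (rep {a} {b} a∈A b∈B a∙b≈g) = ∈-filter⁺ setoid (_∈? _) (∈-resp-≈ setoid) a∈A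
      (∈-resp-≈ setoid (sym (x≈z//y a b _ a∙b≈g))
        (∈-map⁺ setoid setoid (λ b≈b′ → ∙-congˡ (⁻¹-cong b≈b′)) b∈B))

    ∈-reps⁻ : ∀ {g x} → x ∈ₗ reps g → ∃[ y ] (x ∈ A × y ∈ B × x ∙ y ≈ g)
    ∈-reps⁻ {g} x∈ =
      let x∈A , x∈g-B = ∈-filter⁻ setoid (_∈? (g -ˢ B)) (∈-resp-≈ setoid) {xs = elements A} x∈
          y , y∈B , x≈g-y = ∈-map⁻ setoid setoid x∈g-B
      in y , x∈A , y∈B , trans (∙-congʳ x≈g-y) (//-rightDividesˡ y g)

    reps-unique : ∀ g → Unique (reps g)
    reps-unique g = filter⁺ setoid _ (unique A)

    ∈-S₁⁺ : ∀ {g} → Rep g → g ∈ S₁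
    ∈-S₁⁺ {g} ρ = Equivalence.from (∈-+⟨⟩ A B 1 g)
      (Unique⇒length≤ ([] ∷ []) λ { (here v≈a) → ∈-resp-≈ setoid (sym v≈a) (∈-reps⁺ ρ) })

    ∈-S₂⁺ : ∀ {g} (ρ σ : Rep g) → Rep.a ρ ≉ Rep.a σ → g ∈ S₂
    ∈-S₂⁺ {g} ρ σ a≉a′ = Equivalence.from (∈-+⟨⟩ A B 2 g)
      (Unique⇒length≤ (pair-unique a≉a′) (pair-⊆ (∈-reps⁺ ρ) (∈-reps⁺ σ)))

    ∈-S₁⁻ : ∀ {g} → g ∈ S₁ → Rep g
    ∈-S₁⁻ {g} g∈ with reps g in eq | Equivalence.to (∈-+⟨⟩ A B 1 g) g∈
    ... | x ∷ _ | _ = let y , x∈A , y∈B , x∙y≈g = ∈-reps⁻ (≡.subst (x ∈ₗ_) (≡.sym eq) (here refl))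
                      in rep x∈A y∈B x∙y≈g

    ∈-S₂⁻ : ∀ {g} → g ∈ S₂ → ∃₂ λ (ρ σ : Rep g) → Rep.a ρ ≉ Rep.a σ
    ∈-S₂⁻ {g} g∈ =
      let x , x′ , x∈ , x′∈ , x≉x′ = two-elements (reps-unique g) (Equivalence.to (∈-+⟨⟩ A B 2 g) g∈)
          y , x∈A , y∈B , x∙y≈g = ∈-reps⁻ x∈
          y′ , x′∈A , y′∈B , x′∙y′≈g = ∈-reps⁻ x′∈
      in rep x∈A y∈B x∙y≈g , rep x′∈A y′∈B x′∙y′≈g , x≉x′

    S₂⊆S₁ : ∀ {g} → g ∈ S₂ → g ∈ S₁
    S₂⊆S₁ = ∈-S₁⁺ ∘ proj₁ ∘ ∈-S₂⁻

    row-⊆S₁ : ∀ {a ys} → a ∈ A → (∀ {y} → y ∈ₗ ys → y ∈ B) → ∀ {v} → v ∈ₗ row a ys → v ∈ S₁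
    row-⊆S₁ a∈A ys⊆B v∈ = let y , y∈ , v≈ = ∈-row⁻ v∈ in ∈-S₁⁺ (rep a∈A (ys⊆B y∈) (sym v≈))

    column-⊆S₁ : ∀ {b xs} → b ∈ B → (∀ {x} → x ∈ₗ xs → x ∈ A) → ∀ {v} → v ∈ₗ column b xs → v ∈ S₁
    column-⊆S₁ b∈B xs⊆A v∈ = let x , x∈ , v≈ = ∈-column⁻ v∈ in ∈-S₁⁺ (rep (xs⊆A x∈) b∈B (sym v≈))

    -- A sum common to a + B and a′ + B has the two first summands a and a′, so inclusion-exclusion
    -- puts the intersection in `S₂`.
    two-rows : ∀ {a a′} → a ∈ A → a′ ∈ A → a ≉ a′ → ∣ B ∣ + ∣ B ∣ ≤ ∣ S₁ ∣ + ∣ S₂ ∣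
    two-rows {a} {a′} a∈A a′∈A a≉a′ = ≡.subst₂ (λ m n → m + n ≤ ∣ S₁ ∣ + ∣ S₂ ∣)
      (length-map (a ∙_) (elements B)) (length-map (a′ ∙_) (elements B))
      (union-intersection-length (row-unique a (unique B)) (row-unique a′ (unique B))
        (row-⊆S₁ a∈A id) (row-⊆S₁ a′∈A id)
        (λ v∈ v∈′ → let y , y∈ , v≈ = ∈-row⁻ v∈
                        y′ , y′∈ , v≈′ = ∈-row⁻ v∈′
                    in ∈-S₂⁺ (rep a∈A y∈ (sym v≈)) (rep a′∈A y′∈ (sym v≈′)) a≉a′))

    two-columns : ∀ {b b′} → b ∈ B → b′ ∈ B → b ≉ b′ → ∣ A ∣ + ∣ A ∣ ≤ ∣ S₁ ∣ + ∣ S₂ ∣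
    two-columns {b} {b′} b∈B b′∈B b≉b′ = ≡.subst₂ (λ m n → m + n ≤ ∣ S₁ ∣ + ∣ S₂ ∣)
      (length-map (_∙ b) (elements A)) (length-map (_∙ b′) (elements A))
      (union-intersection-length (column-unique b (unique A)) (column-unique b′ (unique A))
        (column-⊆S₁ b∈B id) (column-⊆S₁ b′∈B id)
        (λ {v} v∈ v∈′ → let x , x∈ , v≈ = ∈-column⁻ v∈
                            x′ , x′∈ , v≈′ = ∈-column⁻ v∈′
                        in ∈-S₂⁺ (rep x∈ b∈B (sym v≈)) (rep x′∈ b′∈B (sym v≈′))
          -- Equal first summands would cancel to b ≈ b′.
          (λ x≈x′ → b≉b′ (∙-cancelˡ x b b′ (trans (sym v≈) (trans v≈′ (∙-congʳ (sym x≈x′))))))))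


    -- Classification of pairs.

    -- Adding a - b, so that shift a b b ≈ a.
    shift : Carrier → Carrier → Carrier → Carrier
    shift a b y = (a ∙ y) - b

    -- For a ∈ A, b ∈ B and e = a - b, the set B ∩ (A - e) contains b. The three cases say that it
    -- is all of B, that it is b alone, or that it lies strictly between.
    Good Single Split : Carrier → Carrier → Set (c ⊔ ℓ)
    Good a b   = ∀ {y} → y ∈ B → shift a b y ∈ A
    Single a b = ∀ {y} → y ∈ B → shift a b y ∈ A → y ≈ b
    Split a b  = (∃[ y ] (y ∈ B × y ≉ b × shift a b y ∈ A)) × (∃[ y ] (y ∈ B × ¬ shift a b y ∈ A))

    shift-cong : ∀ {a a′ b b′ y y′} → a ≈ a′ → b ≈ b′ → y ≈ y′ → shift a b y ≈ shift a′ b′ y′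
    shift-cong a≈ b≈ y≈ = ∙-cong (∙-cong a≈ y≈) (⁻¹-cong b≈)

    shift-∙ : ∀ a b y → shift a b y ∙ b ≈ a ∙ y
    shift-∙ a b y = //-rightDividesˡ b (a ∙ y)

    shift-unique : ∀ {a b y x} → x ∙ b ≈ a ∙ y → shift a b y ≈ x
    shift-unique eq = sym (x≈z//y _ _ _ eq)

    shift-injective : ∀ {a b y z} → shift a b y ≈ shift a b z → y ≈ z
    shift-injective eq = ∙-cancelˡ _ _ _ (∙-cancelʳ _ _ _ eq)

    shift-swap : ∀ a b y z → shift a b y ∙ z ≈ shift a b z ∙ y
    shift-swap a b = solve 4 (λ a b⁻¹ y z → ((a :∙ y) :∙ b⁻¹) :∙ z ⊜ ((a :∙ z) :∙ b⁻¹) :∙ y) refl a (- b)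

    Good-resp : ∀ {a a′ b b′} → a ≈ a′ → b ≈ b′ → Good a b → Good a′ b′
    Good-resp a≈ b≈ good y∈B = ∈-resp-≈ setoid (shift-cong a≈ b≈ refl) (good y∈B)

    Single-resp : ∀ {a a′ b b′} → a ≈ a′ → b ≈ b′ → Single a b → Single a′ b′
    Single-resp a≈ b≈ single y∈B y∈ =
      trans (single y∈B (∈-resp-≈ setoid (shift-cong (sym a≈) (sym b≈) refl) y∈)) b≈

    -- The equation says that x is `shift a b y`; so row a and column b cross only in a + b.
    Single-∙ : ∀ {a b x y} → Single a b → x ∈ A → y ∈ B → x ∙ b ≈ a ∙ y → y ≈ b
    Single-∙ single x∈A y∈B eq = single y∈B (∈-resp-≈ setoid (sym (shift-unique eq)) x∈A)

    classify : ∀ a b → Split a b ⊎ (Good a b ⊎ Single a b)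
    classify a b
      with search (λ y≈z → ∈-resp-≈ setoid (shift-cong refl refl y≈z)) (elements B)
             (λ {y} _ → ¬P⊎P (shift a b y ∈? elements A))
         | search (λ y≈z y⇒ z∈ → trans (sym y≈z) (y⇒ (∈-resp-≈ setoid (shift-cong refl refl (sym y≈z)) z∈)))
             (elements B)
             (λ {y} _ → ¬P⊎P ((shift a b y ∈? elements A) →-dec (y ≟ b)))
    ... | inj₂ good | _           = inj₂ (inj₁ good)
    ... | inj₁ _    | inj₂ single = inj₂ (inj₂ single)
    -- A false implication between decidable statements has a false conclusion, here y ≉ b, and a
    -- true premise.
    ... | inj₁ out  | inj₁ (y , y∈B , ¬single) = inj₁
      ((y , y∈B , (λ y≈b → ¬single (λ _ → y≈b)) ,
        decidable-stable (shift a b y ∈? elements A) (λ y∉ → ¬single (⊥-elim ∘ y∉))) , out)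

    -- The column A + b and the row a + B without a + b are disjoint, and together have at least |A|
    -- + |B| - 1 elements.
    Single⇒cross : ∀ {a b} → Single a b → a ∈ A → b ∈ B → ∀ S →
      (∀ {y} → y ∈ B → a ∙ y ∈ S) → (∀ {x} → x ∈ A → x ∙ b ∈ S) → ∣ A ∣ + ∣ B ∣ ≤ suc ∣ S ∣
    Single⇒cross {a} {b} single a∈A b∈B S row⊆S column⊆S = begin
      ∣ A ∣ + ∣ B ∣                 ≤⟨ ℕ.+-monoʳ-≤ (∣ A ∣) (∣A∣≤1+∣A∖b∣ B b) ⟩
      ∣ A ∣ + suc ∣ B ∖ b ∣         ≡⟨ ℕ.+-suc (∣ A ∣) (∣ B ∖ b ∣) ⟩
      suc (∣ A ∣ + ∣ B ∖ b ∣)       ≤⟨ s≤s (≡.subst₂ (λ m n → m + n ≤ ∣ S ∣)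
        (length-map (_∙ b) (elements A)) (length-map (a ∙_) (elements (B ∖ b)))
        (disjoint-length (column-unique b (unique A)) (row-unique a (unique (B ∖ b)))
          (λ v∈ → let x , x∈A , v≈ = ∈-column⁻ v∈ in ∈-resp-≈ setoid (sym v≈) (column⊆S x∈A))
          (λ v∈ → let y , y∈ , v≈ = ∈-row⁻ v∈ in ∈-resp-≈ setoid (sym v≈) (row⊆S (proj₁ (∈-∖⁻ B y∈))))
          (λ v∈ v∈′ → let x , x∈A , v≈ = ∈-column⁻ v∈
                          y , y∈ , v≈′ = ∈-row⁻ v∈′
                          y∈B , y≉b = ∈-∖⁻ B y∈
                      in y≉b (Single-∙ single x∈A y∈B (trans (sym v≈) v≈′))))) ⟩
      suc ∣ S ∣                     ∎
      where open ℕ.≤-Reasoning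

  -- The two alternatives.

  -- The 4 stands on the right to avoid truncated subtraction.
  Bound : FinSubset → FinSubset → Set
  Bound A B = 2 * ∣ A ∣ + 2 * ∣ B ∣ ≤ (∣ A +⟨ 1 ⟩ B ∣ + ∣ A +⟨ 2 ⟩ B ∣) + 4

  CosetIn : FinSubset → Set (c ⊔ ℓ)
  CosetIn S = ∃[ x ] ∃[ H ] (IsSubgroup H × ∣ H ∣ ≥ 3 × x +ᶜ H ⊆ S)

  CosetIn-mono : ∀ S T → (∀ {g} → g ∈ S → g ∈ T) → CosetIn S → CosetIn T
  CosetIn-mono S T S⊆T (x , H , H≤G , ∣H∣≥3 , x+H⊆S) = x , H , H≤G , ∣H∣≥3 , λ h∈ → S⊆T (x+H⊆S h∈)

  -- The Dyson transform.

  -- The Dyson e-transform with e = a - b: A⁺ = A ∪ (B + e), B⁻ = B ∩ (A - e).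
  module DysonTransform (A B : FinSubset) (a b : Carrier) where

    open Sums A B

    private
      τ : Carrier → Carrier
      τ = shift a b

      τ∈A? : ∀ y → Dec (τ y ∈ A)
      τ∈A? y = τ y ∈? elements A

      τ∈A-resp : ∀ {y z} → y ≈ z → τ y ∈ A → τ z ∈ A
      τ∈A-resp y≈z = ∈-resp-≈ setoid (shift-cong refl refl y≈z)

      τ∉A-resp : ∀ {y z} → y ≈ z → ¬ τ y ∈ A → ¬ τ z ∈ A
      τ∉A-resp y≈z y∉ z∈ = y∉ (τ∈A-resp (sym y≈z) z∈)

      new : List Carrier
      new = filter (λ y → ¬? (τ∈A? y)) (elements B)

      new⁻ : ∀ {x} → x ∈ₗ map τ new → ∃[ z ] (z ∈ B × x ≈ τ z × ¬ x ∈ A)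
      new⁻ x∈ =
        let z , z∈ , x≈τz = ∈-map⁻ setoid setoid x∈
            z∈B , τz∉A = ∈-filter⁻ setoid (λ y → ¬? (τ∈A? y)) τ∉A-resp {xs = elements B} z∈
        in z , z∈B , x≈τz , λ x∈A → τz∉A (∈-resp-≈ setoid x≈τz x∈A)

    A⁺ B⁻ : FinSubset
    A⁺ = record
      { elements = elements A ++ map τ new
      ; unique   = ++⁺ setoid (unique A)
          (map⁺ setoid setoid shift-injective (filter⁺ setoid _ (unique B)))
          (λ (v∈A , v∈new) → let _ , _ , _ , v∉A = new⁻ v∈new in v∉A v∈A)
      }
    B⁻ = record
      { elements = filter τ∈A? (elements B)
      ; unique   = filter⁺ setoid _ (unique B)
      }

    ∈-B⁻⁻ : ∀ {y} → y ∈ B⁻ → y ∈ B × τ y ∈ A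
    ∈-B⁻⁻ = ∈-filter⁻ setoid τ∈A? τ∈A-resp {xs = elements B}

    ∈-B⁻⁺ : ∀ {y} → y ∈ B → τ y ∈ A → y ∈ B⁻
    ∈-B⁻⁺ = ∈-filter⁺ setoid τ∈A? τ∈A-resp {xs = elements B}

    -- The elements that B loses are those of `new`, and their translates by e are what A gains.
    ∣A⁺∣+∣B⁻∣ : ∣ A⁺ ∣ + ∣ B⁻ ∣ ≡ ∣ A ∣ + ∣ B ∣
    ∣A⁺∣+∣B⁻∣ = begin
      ∣ A⁺ ∣ + ∣ B⁻ ∣                        ≡⟨ ≡.cong (_+ ∣ B⁻ ∣) (length-++ (elements A)) ⟩
      ∣ A ∣ + length (map τ new) + ∣ B⁻ ∣    ≡⟨ ≡.cong (λ n → ∣ A ∣ + n + ∣ B⁻ ∣) (length-map τ new) ⟩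
      ∣ A ∣ + length new + ∣ B⁻ ∣            ≡⟨ swap (∣ A ∣) (length new) (∣ B⁻ ∣) ⟩
      ∣ A ∣ + (∣ B⁻ ∣ + length new)          ≡⟨ ≡.cong (∣ A ∣ +_) (length-filter-complement τ∈A? (elements B)) ⟩
      ∣ A ∣ + ∣ B ∣                          ∎
      where
      open ≡.≡-Reasoning
      swap : ∀ x n y → x + n + y ≡ x + (y + n)
      swap = solve-∀

    module T = Sums A⁺ B⁻

    -- How a representation x + y from `A⁺` and `B⁻` turns into one from A and B with the indexed
    -- first summand. If x is not in A, then x ≈ τ z with z ∈ B, and x + y ≈ τ y + z.
    data Origin (x y : Carrier) : Carrier → Set (c ⊔ ℓ) where
      kept    : Origin x y x
      shifted : ¬ x ∈ A → Origin x y (τ y)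

    pull : ∀ {g} (ρ : T.Rep g) → ∃[ σ ] Origin (T.Rep.a ρ) (T.Rep.b ρ) (Rep.a {g} σ)
    pull (T.rep {x} {y} x∈ y∈ x∙y≈g) with ∈-++⁻ setoid (elements A) x∈
    ... | inj₁ x∈A = rep x∈A (proj₁ (∈-B⁻⁻ y∈)) x∙y≈g , kept
    ... | inj₂ x∈new =
      let z , z∈B , x≈τz , x∉A = new⁻ x∈new
      in rep (proj₂ (∈-B⁻⁻ y∈)) z∈B (trans (shift-swap a b y z) (trans (∙-congʳ (sym x≈τz)) x∙y≈g))
       , shifted x∉A

    -- If x ≈ τ y′, then x′ + y′ ≈ τ y′ + y ≈ τ y + y′, so x′ ≈ τ y, which lies in A because y ∈
    -- `B⁻`.
    kept≉shifted : ∀ {x y x′ y′} → x ∙ y ≈ x′ ∙ y′ → y ∈ B⁻ → ¬ x′ ∈ A → x ≉ τ y′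
    kept≉shifted {x} {y} {x′} {y′} eq y∈ x′∉A x≈τy′ = x′∉A (∈-resp-≈ setoid τy≈x′ (proj₂ (∈-B⁻⁻ y∈)))
      where
      τy≈x′ : τ y ≈ x′
      τy≈x′ = ∙-cancelʳ y′ _ _ (trans (shift-swap a b y y′) (trans (∙-congʳ (sym x≈τy′)) eq))

    -- Distinct representations of one sum stay distinct when pulled back, so the transform
    -- increases no r(g).
    Origin-injective : ∀ {x y x′ y′ p p′} → Origin x y p → Origin x′ y′ p′ →
      x ∙ y ≈ x′ ∙ y′ → y ∈ B⁻ → y′ ∈ B⁻ → p ≈ p′ → x ≈ x′
    Origin-injective kept kept _ _ _ p≈p′ = p≈p′
    Origin-injective kept (shifted x′∉A) eq y∈ _ p≈p′ =
      contradiction p≈p′ (kept≉shifted eq y∈ x′∉A)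
    Origin-injective (shifted x∉A) kept eq _ y′∈ p≈p′ =
      contradiction (sym p≈p′) (kept≉shifted (sym eq) y′∈ x∉A)
    Origin-injective (shifted _) (shifted _) eq _ _ p≈p′ =
      ∙-cancelʳ _ _ _ (trans eq (∙-congˡ (sym (shift-injective p≈p′))))

    S₁-mono : ∀ {g} → g ∈ T.S₁ → g ∈ S₁
    S₁-mono g∈ = ∈-S₁⁺ (proj₁ (pull (T.∈-S₁⁻ g∈)))

    S₂-mono : ∀ {g} → g ∈ T.S₂ → g ∈ S₂
    S₂-mono g∈ =
      let ρ , σ , x≉x′ = T.∈-S₂⁻ g∈
          ρ′ , o = pull ρ
          σ′ , o′ = pull σ
      in ∈-S₂⁺ ρ′ σ′ λ p≈p′ → x≉x′ (Origin-injective o o′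
           (trans (T.Rep.a∙b≈g ρ) (sym (T.Rep.a∙b≈g σ))) (T.Rep.b∈B ρ) (T.Rep.b∈B σ) p≈p′)

    transform : Bound A⁺ B⁻ ⊎ CosetIn T.S₂ → Bound A B ⊎ CosetIn S₂
    transform (inj₂ coset) = inj₂ (CosetIn-mono T.S₂ S₂ S₂-mono coset)
    transform (inj₁ ih) = inj₁ (begin
      2 * ∣ A ∣ + 2 * ∣ B ∣         ≡⟨ ℕ.*-distribˡ-+ 2 (∣ A ∣) (∣ B ∣) ⟨
      2 * (∣ A ∣ + ∣ B ∣)           ≡⟨ ≡.cong (2 *_) ∣A⁺∣+∣B⁻∣ ⟨
      2 * (∣ A⁺ ∣ + ∣ B⁻ ∣)         ≡⟨ ℕ.*-distribˡ-+ 2 (∣ A⁺ ∣) (∣ B⁻ ∣) ⟩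
      2 * ∣ A⁺ ∣ + 2 * ∣ B⁻ ∣       ≤⟨ ih ⟩
      (∣ T.S₁ ∣ + ∣ T.S₂ ∣) + 4     ≤⟨ ℕ.+-monoˡ-≤ 4 (ℕ.+-mono-≤
        (Unique⇒length≤ (unique T.S₁) S₁-mono) (Unique⇒length≤ (unique T.S₂) S₂-mono)) ⟩
      (∣ S₁ ∣ + ∣ S₂ ∣) + 4         ∎)
      where open ℕ.≤-Reasoning

    module _ (split : Split a b) (b∈B : b ∈ B) (a∈A : a ∈ A) where

      -- Besides the y ≉ b given by `split`, b itself survives, since its shift is a.
      2≤∣B⁻∣ : 2 ≤ ∣ B⁻ ∣
      2≤∣B⁻∣ = let (y , y∈B , y≉b , τy∈A) , _ = split in
        Unique⇒length≤ (pair-unique y≉b)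
          (pair-⊆ (∈-B⁻⁺ y∈B τy∈A) (∈-B⁻⁺ b∈B (∈-resp-≈ setoid (sym (//-rightDividesʳ b a)) a∈A)))

      ∣B⁻∣<∣B∣ : ∣ B⁻ ∣ < ∣ B ∣
      ∣B⁻∣<∣B∣ = let _ , (z , z∈B , τz∉A) = split in
        filter-notAll τ∈A? (elements B) (Any.map (λ z≈y → τ∉A-resp z≈y τz∉A) z∈B)

  -- Removing an element all of whose pairs are Single.

  module _ (A B : FinSubset) where

    open Sums A B

    -- Without a, the |B| ≥ 2 sums of row a disappear from `S₁`, which pays for the decrease of 2|A|
    -- by 2.
    remove-Single : ∀ {a} → a ∈ A → (∀ {b} → b ∈ B → Single a b) → 2 ≤ ∣ B ∣ →
      Bound (A ∖ a) B ⊎ CosetIn (A ∖ a +⟨ 2 ⟩ B) → Bound A B ⊎ CosetIn S₂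
    remove-Single {a} a∈A single 2≤∣B∣ = [ inj₁ ∘ bound , inj₂ ∘ CosetIn-mono R.S₂ S₂ S₂-mono ]′
      where
      module R = Sums (A ∖ a) B

      weaken : ∀ {g} → R.Rep g → Rep g
      weaken (R.rep x∈ y∈ eq) = rep (proj₁ (∈-∖⁻ A x∈)) y∈ eq

      S₂-mono : ∀ {g} → g ∈ R.S₂ → g ∈ S₂
      S₂-mono g∈ = let ρ , σ , a≉a′ = R.∈-S₂⁻ g∈ in ∈-S₂⁺ (weaken ρ) (weaken σ) a≉a′

      S₁-bound : ∣ R.S₁ ∣ + ∣ B ∣ ≤ ∣ S₁ ∣
      S₁-bound = ≡.subst (λ n → ∣ R.S₁ ∣ + n ≤ ∣ S₁ ∣) (length-map (a ∙_) (elements B))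
        (disjoint-length (unique R.S₁) (row-unique a (unique B))
          (∈-S₁⁺ ∘ weaken ∘ R.∈-S₁⁻) (row-⊆S₁ a∈A id) disjoint)
        where
        disjoint : ∀ {v} → v ∈ R.S₁ → ¬ v ∈ₗ row a (elements B)
        -- If x + y ≈ a + z, then `Single a y` forces z ≈ y, and hence x ≈ a.
        disjoint v∈ v∈row =
          let R.rep {x} {y} x∈ y∈B x∙y≈v = R.∈-S₁⁻ v∈
              z , z∈B , v≈a∙z = ∈-row⁻ v∈row
              x∈A , x≉a = ∈-∖⁻ A x∈
              x∙y≈a∙z = trans x∙y≈v v≈a∙z
              z≈y = Single-∙ (single y∈B) x∈A z∈B x∙y≈a∙z
          in x≉a (∙-cancelʳ y x a (trans x∙y≈a∙z (∙-congˡ z≈y)))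

      bound : Bound (A ∖ a) B → Bound A B
      bound ih = begin
        2 * ∣ A ∣ + 2 * ∣ B ∣                    ≤⟨ ℕ.+-monoˡ-≤ (2 * ∣ B ∣) (ℕ.*-monoʳ-≤ 2 (∣A∣≤1+∣A∖b∣ A a)) ⟩
        2 * suc ∣ A ∖ a ∣ + 2 * ∣ B ∣            ≡⟨ eq₁ (∣ A ∖ a ∣) (2 * (∣ B ∣)) ⟩
        2 + (2 * ∣ A ∖ a ∣ + 2 * ∣ B ∣)          ≤⟨ ℕ.+-mono-≤ 2≤∣B∣ ih ⟩
        ∣ B ∣ + (∣ R.S₁ ∣ + ∣ R.S₂ ∣ + 4)        ≡⟨ eq₂ (∣ B ∣) (∣ R.S₁ ∣) (∣ R.S₂ ∣) ⟩
        (∣ R.S₁ ∣ + ∣ B ∣) + ∣ R.S₂ ∣ + 4        ≤⟨ ℕ.+-monoˡ-≤ 4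
          (ℕ.+-mono-≤ S₁-bound (Unique⇒length≤ (unique R.S₂) S₂-mono)) ⟩
        (∣ S₁ ∣ + ∣ S₂ ∣) + 4                    ∎
        where
        open ℕ.≤-Reasoning
        eq₁ : ∀ x y → 2 * suc x + y ≡ 2 + (2 * x + y)
        eq₁ = solve-∀
        eq₂ : ∀ x y z → x + (y + z + 4) ≡ (y + x) + z + 4
        eq₂ = solve-∀

    -- The coset in the case of Good pairs only.

    -- Each y - b with y ∈ B maps A into itself, so the stabiliser H of A contains B - b and has at
    -- least 3 elements.
    all-Good⇒coset : ∣ A ∣ ≥ 2 → ∣ B ∣ ≥ 3 → (∀ {a b} → a ∈ A → b ∈ B → Good a b) → CosetIn S₂
    all-Good⇒coset ∣A∣≥2 ∣B∣≥3 good
      with a , _ , a∈A , _ ← two-elements (unique A) ∣A∣≥2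
         | b , b′ , b∈B , b′∈B , b≉b′ ← two-elements (unique B) (ℕ.<⇒≤ ∣B∣≥3)
      = a ∙ b , H , subgroup , ∣H∣≥3 , coset
      where
      Stabilises : Carrier → Set (c ⊔ ℓ)
      Stabilises h = ∀ {x} → x ∈ A → x ∙ h ∈ A

      Stabilises-resp : ∀ {h k} → h ≈ k → Stabilises h → Stabilises k
      Stabilises-resp h≈k stab x∈A = ∈-resp-≈ setoid (∙-congˡ h≈k) (stab x∈A)

      stabilises? : ∀ h → Dec (Stabilises h)
      stabilises? h
        with search {Q = λ x → x ∙ h ∈ A} (λ x≈y → ∈-resp-≈ setoid (∙-congʳ x≈y)) (elements A)
               (λ {x} _ → ¬P⊎P (x ∙ h ∈? elements A))
      ... | inj₁ (x , x∈A , ¬x∙h∈A) = no λ stab → ¬x∙h∈A (stab x∈A)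
      ... | inj₂ stab = yes stab

      -- A stabilising h satisfies a + h ∈ A, so all candidates lie in the finite set A - a.
      H : FinSubset
      H = record
        { elements = filter stabilises? (column (- a) (elements A))
        ; unique   = filter⁺ setoid _ (column-unique (- a) (unique A))
        }

      ∈-H⁻ : ∀ {h} → h ∈ H → Stabilises h
      ∈-H⁻ h∈ = proj₂ (∈-filter⁻ setoid stabilises? Stabilises-resp {xs = column (- a) (elements A)} h∈)

      ∈-H⁺ : ∀ {h} → Stabilises h → h ∈ H
      ∈-H⁺ {h} stab = ∈-filter⁺ setoid stabilises? Stabilises-resp
        (∈-resp-≈ setoid (xyx⁻¹≈y a h) (∈-map⁺ setoid setoid ∙-congʳ (stab a∈A))) stab

      -- Translation by h is injective on the finite set A, hence onto A.
      neg-stab : ∀ {h} → Stabilises h → Stabilises (- h)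
      neg-stab {h} stab {x} x∈A with x ∈? column h (elements A)
      ... | yes x∈ = let y , y∈A , x≈y∙h = ∈-column⁻ x∈
                     in ∈-resp-≈ setoid (sym (trans (∙-congʳ x≈y∙h) (//-rightDividesʳ h y))) y∈A
      ... | no x∉ = contradiction
        (Unique⇒length≤ (¬Any⇒All¬ _ x∉ ∷ column-unique h (unique A))
          (λ { (here v≈x) → ∈-resp-≈ setoid (sym v≈x) x∈A
             ; (there v∈) → let y , y∈A , v≈ = ∈-column⁻ v∈ in ∈-resp-≈ setoid (sym v≈) (stab y∈A) }))
        (ℕ.<⇒≱ (s≤s (ℕ.≤-reflexive (≡.sym (length-map (_∙ h) (elements A))))))

      subgroup : IsSubgroup H
      subgroup = record
        { 0#-closed  = ∈-H⁺ λ x∈A → ∈-resp-≈ setoid (sym (identityʳ _)) x∈A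
        ; +-closed   = λ h∈ k∈ → ∈-H⁺ λ x∈A → ∈-resp-≈ setoid (assoc _ _ _) (∈-H⁻ k∈ (∈-H⁻ h∈ x∈A))
        ; neg-closed = λ h∈ → ∈-H⁺ (neg-stab (∈-H⁻ h∈))
        }

      ∣H∣≥3 : ∣ H ∣ ≥ 3
      ∣H∣≥3 = ℕ.≤-trans ∣B∣≥3 (≡.subst (_≤ ∣ H ∣) (length-map (_∙ (- b)) (elements B))
        (Unique⇒length≤ (column-unique (- b) (unique B)) λ v∈ →
          let y , y∈B , v≈y-b = ∈-column⁻ v∈
          in ∈-H⁺ (Stabilises-resp (sym v≈y-b) λ x∈A → ∈-resp-≈ setoid (assoc _ _ _) (good x∈A b∈B y∈B))))

      coset : (a ∙ b) +ᶜ H ⊆ S₂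
      -- The second representation of x + b is (x + b - b′) + b′: its first summand is in A by Good,
      -- and is not x because b ≉ b′.
      coset {h} h∈ = ∈-S₂⁺ (rep x∈A b∈B x∙b≈g) (rep (good x∈A b′∈B b∈B) b′∈B (trans (shift-∙ x b′ b) x∙b≈g))
        (λ x≈ → b≉b′ (sym (∙-cancelˡ x b′ b (trans (∙-congʳ x≈) (shift-∙ x b′ b)))))
        where
        x = a ∙ h
        x∈A = ∈-H⁻ h∈ a∈A
        x∙b≈g : x ∙ b ≈ (a ∙ b) ∙ h
        x∙b≈g = solve 3 (λ a h b → (a :∙ h) :∙ b ⊜ (a :∙ b) :∙ h) refl a h b

    -- A Single pair when every sum is popular.

    -- The cross through a + b lies in both `S₁` and `S₂`, giving 2|A| + 2|B| - 2, which is 2 more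
    -- than required.
    all-popular⇒Bound : ∀ {a b} → a ∈ A → b ∈ B → Single a b →
      (∀ {x y} → x ∈ A → y ∈ B → x ∙ y ∈ S₂) → Bound A B
    all-popular⇒Bound {a} {b} a∈A b∈B single popular = begin
      2 * ∣ A ∣ + 2 * ∣ B ∣             ≡⟨ eq₁ (∣ A ∣) (∣ B ∣) ⟩
      (∣ A ∣ + ∣ B ∣) + (∣ A ∣ + ∣ B ∣) ≤⟨ ℕ.+-mono-≤
        (cross S₁ (λ x∈A y∈B → ∈-S₁⁺ (rep x∈A y∈B refl))) (cross S₂ popular) ⟩
      suc ∣ S₁ ∣ + suc ∣ S₂ ∣           ≤⟨ ℕ.m≤m+n _ 2 ⟩
      suc ∣ S₁ ∣ + suc ∣ S₂ ∣ + 2       ≡⟨ eq₂ (∣ S₁ ∣) (∣ S₂ ∣) ⟩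
      (∣ S₁ ∣ + ∣ S₂ ∣) + 4             ∎
      where
      open ℕ.≤-Reasoning
      cross : ∀ S → (∀ {x y} → x ∈ A → y ∈ B → x ∙ y ∈ S) → ∣ A ∣ + ∣ B ∣ ≤ suc ∣ S ∣
      cross S sums⊆S = Single⇒cross single a∈A b∈B S (sums⊆S a∈A) (λ x∈A → sums⊆S x∈A b∈B)
      eq₁ : ∀ x y → 2 * x + 2 * y ≡ (x + y) + (x + y)
      eq₁ = solve-∀
      eq₂ : ∀ x y → suc x + suc y + 2 ≡ (x + y) + 4
      eq₂ = solve-∀

    -- A sum a + b with no other representation.

    module UnpopularSum {a b} (a∈A : a ∈ A) (b∈B : b ∈ B) (a∙b∉S₂ : ¬ a ∙ b ∈ S₂)
      (dichotomy : ∀ {x y} → x ∈ A → y ∈ B → Good x y ⊎ Single x y)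
      (some-Good : ∀ {x} → x ∈ A → ∃[ y ] (y ∈ B × Good x y)) where

      only-rep : ∀ {x y} → x ∈ A → y ∈ B → x ∙ y ≈ a ∙ b → x ≈ a
      only-rep {x} x∈A y∈B eq with x ≟ a
      ... | yes x≈a = x≈a
      ... | no  x≉a = contradiction (∈-S₂⁺ (rep x∈A y∈B eq) (rep a∈A b∈B refl) x≉a) a∙b∉S₂

      -- Good puts a + b - y in A, and adding y represents a + b again; as a + b has one
      -- representation only, a + b - y ≈ a.
      Good⇒≈b : ∀ {y} → y ∈ B → Good a y → y ≈ b
      Good⇒≈b {y} y∈B good = ∙-cancelˡ a y b (trans (∙-congʳ (sym x≈a)) (shift-∙ a y b))
        where
        x≈a : shift a y b ≈ a
        x≈a = only-rep (good b∈B) y∈B (shift-∙ a y b)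

      Good-ab : Good a b
      Good-ab = let y , y∈B , good = some-Good a∈A in Good-resp refl (Good⇒≈b y∈B good) good

      Single-a : ∀ {y} → y ∈ B → y ≉ b → Single a y
      Single-a y∈B y≉b with dichotomy a∈A y∈B
      ... | inj₁ good   = contradiction (Good⇒≈b y∈B good) y≉b
      ... | inj₂ single = single

      -- By `Good-ab`, (a - b + y) + b is a second representation.
      a∙y∈S₂ : ∀ {y} → y ∈ B → y ≉ b → a ∙ y ∈ S₂
      a∙y∈S₂ {y} y∈B y≉b = ∈-S₂⁺ (rep a∈A y∈B refl) (rep (Good-ab y∈B) b∈B (shift-∙ a b y))
        (λ a≈x → y≉b (∙-cancelˡ a y b (trans (sym (shift-∙ a b y)) (∙-congʳ (sym a≈x)))))

      popular? : ∀ y x → Dec (x ∙ y ∈ S₂)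
      popular? y x = x ∙ y ∈? elements S₂

      popular unpopular : Carrier → List Carrier
      popular y   = filter (popular? y) (elements A)
      unpopular y = filter (λ x → ¬? (popular? y x)) (elements A)

      popular⁻ : ∀ {y x} → x ∈ₗ popular y → x ∈ A × x ∙ y ∈ S₂
      popular⁻ {y} = ∈-filter⁻ setoid (popular? y) (λ x≈z → ∈-resp-≈ setoid (∙-congʳ x≈z)) {xs = elements A}

      unpopular⁻ : ∀ {y x} → x ∈ₗ unpopular y → x ∈ A × ¬ x ∙ y ∈ S₂
      unpopular⁻ {y} = ∈-filter⁻ setoid (λ x → ¬? (popular? y x))
        (λ x≈z x∉ z∈ → x∉ (∈-resp-≈ setoid (∙-congʳ (sym x≈z)) z∈)) {xs = elements A}

      module _ {y z} (y∈B : y ∈ B) (z∈B : z ∈ B) (y≉b : y ≉ b) (z≉b : z ≉ b) (y≉z : y ≉ z) where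

        private
          cross : List Carrier
          cross = column y (elements A) ++ row a (elements (B ∖ y))

          cross⁻ : ∀ {v} → v ∈ₗ cross → (∃[ x ] (x ∈ A × v ≈ x ∙ y)) ⊎ (∃[ w ] (w ∈ B ∖ y × v ≈ a ∙ w))
          cross⁻ v∈ = [ inj₁ ∘ ∈-column⁻ , inj₂ ∘ ∈-row⁻ ]′ (∈-++⁻ setoid (column y (elements A)) v∈)

          row#column : ∀ {x w v} → x ∈ A → w ∈ B ∖ y → v ≈ x ∙ y → ¬ v ≈ a ∙ w
          row#column x∈A w∈ v≈ v≈′ = let w∈B , w≉y = ∈-∖⁻ B w∈ in
            w≉y (Single-∙ (Single-a y∈B y≉b) x∈A w∈B (trans (sym v≈) v≈′))

          cross-unique : Unique cross
          cross-unique = ++⁺ setoid (column-unique y (unique A)) (row-unique a (unique (B ∖ y)))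
            λ (v∈ , v∈′) → let _ , x∈A , v≈ = ∈-column⁻ v∈
                               _ , w∈ , v≈′ = ∈-row⁻ v∈′
                           in row#column x∈A w∈ v≈ v≈′

          cross⊆S₁ : ∀ {v} → v ∈ₗ cross → v ∈ S₁
          cross⊆S₁ v∈ = [ column-⊆S₁ y∈B id , row-⊆S₁ a∈A (proj₁ ∘ ∈-∖⁻ B) ]′
            (∈-++⁻ setoid (column y (elements A)) v∈)

          -- An unpopular x + z on the cross would have a second representation, from column y or
          -- from row a. In row a the case x ≈ a is left, but a + z is popular.
          unpopular#cross : ∀ {v} → v ∈ₗ column z (unpopular z) → ¬ v ∈ₗ cross
          unpopular#cross v∈ v∈cross with ∈-column⁻ v∈ | cross⁻ v∈cross
          ... | x , x∈ , v≈x∙z | inj₁ (x′ , x′∈A , v≈x′∙y) =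
            let x∈A , x∙z∉S₂ = unpopular⁻ x∈
                x∙z≈x′∙y = trans (sym v≈x∙z) v≈x′∙y
            in x∙z∉S₂ (∈-S₂⁺ (rep x∈A z∈B refl) (rep x′∈A y∈B (sym x∙z≈x′∙y))
                 (λ x≈x′ → y≉z (∙-cancelˡ x y z (trans (∙-congʳ x≈x′) (sym x∙z≈x′∙y)))))
          ... | x , x∈ , v≈x∙z | inj₂ (w , w∈ , v≈a∙w) =
            let x∈A , x∙z∉S₂ = unpopular⁻ x∈
                w∈B , _ = ∈-∖⁻ B w∈
            in x∙z∉S₂ (∈-S₂⁺ (rep x∈A z∈B refl) (rep a∈A w∈B (trans (sym v≈a∙w) v≈x∙z))
                 (λ x≈a → x∙z∉S₂ (∈-resp-≈ setoid (∙-congʳ (sym x≈a)) (a∙y∈S₂ z∈B z≉b))))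

        S₁-bound : (∣ A ∣ + ∣ B ∖ y ∣) + length (unpopular z) ≤ ∣ S₁ ∣
        S₁-bound = begin
          (∣ A ∣ + ∣ B ∖ y ∣) + length (unpopular z)
            ≡⟨ ≡.cong₂ _+_
                 (≡.cong₂ _+_ (length-map (_∙ y) (elements A)) (length-map (a ∙_) (elements (B ∖ y))))
                 (length-map (_∙ z) (unpopular z)) ⟨
          (length (column y (elements A)) + length (row a (elements (B ∖ y)))) + length (column z (unpopular z))
            ≡⟨ ≡.cong (_+ length (column z (unpopular z))) (length-++ (column y (elements A))) ⟨
          length cross + length (column z (unpopular z))
            ≤⟨ disjoint-length cross-unique (column-unique z (filter⁺ setoid _ (unique A)))
                 cross⊆S₁ (column-⊆S₁ z∈B (proj₁ ∘ unpopular⁻)) (λ v∈cross v∈ → unpopular#cross v∈ v∈cross) ⟩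
          ∣ S₁ ∣ ∎
          where open ℕ.≤-Reasoning

        -- In row a, y is left out because a + y already belongs to column y, and b because a + b is
        -- unpopular.
        S₂-bound : length (popular y) + ∣ B ∖ y ∖ b ∣ ≤ ∣ S₂ ∣
        S₂-bound = ≡.subst₂ (λ m n → m + n ≤ ∣ S₂ ∣)
          (length-map (_∙ y) (popular y)) (length-map (a ∙_) (elements (B ∖ y ∖ b)))
          (disjoint-length (column-unique y (filter⁺ setoid _ (unique A))) (row-unique a (unique (B ∖ y ∖ b)))
            (λ v∈ → let _ , x∈ , v≈ = ∈-column⁻ v∈ in ∈-resp-≈ setoid (sym v≈) (proj₂ (popular⁻ x∈)))
            (λ v∈ → let _ , w∈ , v≈ = ∈-row⁻ v∈
                        w∈B∖y , w≉b = ∈-∖⁻ (B ∖ y) w∈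
                    in ∈-resp-≈ setoid (sym v≈) (a∙y∈S₂ (proj₁ (∈-∖⁻ B w∈B∖y)) w≉b))
            (λ v∈ v∈′ → let _ , x∈ , v≈ = ∈-column⁻ v∈
                            _ , w∈ , v≈′ = ∈-row⁻ v∈′
                        in row#column (proj₁ (popular⁻ x∈)) (proj₁ (∈-∖⁻ (B ∖ y) w∈)) v≈ v≈′))

        -- With u(y) unpopular sums in column y, `S₁` has at least |A| + |B| - 1 + u(z) elements and
        -- `S₂` at least |A| - u(y) + |B| - 2.
        unpopular≤⇒Bound : length (unpopular y) ≤ length (unpopular z) → Bound A B
        unpopular≤⇒Bound u≤u′ = begin
          2 * ∣ A ∣ + 2 * ∣ B ∣
            ≡⟨ eq₁ (∣ A ∣) (∣ B ∣) ⟩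
          (∣ A ∣ + ∣ A ∣) + (∣ B ∣ + ∣ B ∣)
            ≤⟨ ℕ.+-mono-≤
                 (ℕ.+-monoʳ-≤ (∣ A ∣) (ℕ.≤-trans
                   (ℕ.≤-reflexive (≡.sym (length-filter-complement (popular? y) (elements A))))
                   (ℕ.+-monoʳ-≤ (length (popular y)) u≤u′)))
                 (ℕ.+-mono-≤ (∣A∣≤1+∣A∖b∣ B y) (ℕ.≤-trans (∣A∣≤1+∣A∖b∣ B y) (s≤s (∣A∣≤1+∣A∖b∣ (B ∖ y) b)))) ⟩
          (∣ A ∣ + (length (popular y) + length (unpopular z))) + (suc ∣ B ∖ y ∣ + suc (suc ∣ B ∖ y ∖ b ∣))
            -- The count exceeds the required bound by 1.
            ≤⟨ ℕ.n≤1+n _ ⟩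
          suc ((∣ A ∣ + (length (popular y) + length (unpopular z))) + (suc ∣ B ∖ y ∣ + suc (suc ∣ B ∖ y ∖ b ∣)))
            ≡⟨ eq₂ (∣ A ∣) (length (popular y)) (length (unpopular z)) (∣ B ∖ y ∣) (∣ B ∖ y ∖ b ∣) ⟩
          (((∣ A ∣ + ∣ B ∖ y ∣) + length (unpopular z)) + (length (popular y) + ∣ B ∖ y ∖ b ∣)) + 4
            ≤⟨ ℕ.+-monoˡ-≤ 4 (ℕ.+-mono-≤ S₁-bound S₂-bound) ⟩
          (∣ S₁ ∣ + ∣ S₂ ∣) + 4 ∎
          where
          open ℕ.≤-Reasoning
          eq₁ : ∀ x y → 2 * x + 2 * y ≡ (x + x) + (y + y)
          eq₁ = solve-∀
          eq₂ : ∀ x p u v w → suc ((x + (p + u)) + (suc v + suc (suc w))) ≡ (((x + v) + u) + (p + w)) + 4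
          eq₂ = solve-∀

      unpopular-sum⇒Bound : ∣ B ∣ ≥ 3 → Bound A B
      unpopular-sum⇒Bound ∣B∣≥3
        with y , z , y∈ , z∈ , y≉z ← two-elements (unique (B ∖ b)) (s≤s⁻¹ (ℕ.≤-trans ∣B∣≥3 (∣A∣≤1+∣A∖b∣ B b)))
        with y∈B , y≉b ← ∈-∖⁻ B y∈ | z∈B , z≉b ← ∈-∖⁻ B z∈
        -- The roles of y and z are symmetric; the cross goes through the column with fewer
        -- unpopular sums.
        with ℕ.≤-total (length (unpopular y)) (length (unpopular z))
      ... | inj₁ u≤u′ = unpopular≤⇒Bound y∈B z∈B y≉b z≉b y≉z u≤u′
      ... | inj₂ u′≤u = unpopular≤⇒Bound z∈B y∈B z≉b y≉b (y≉z ∘ sym) u′≤u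

    no-Split : ∣ A ∣ ≥ 2 → ∣ B ∣ ≥ 3 →
      (∀ {x y} → x ∈ A → y ∈ B → Good x y ⊎ Single x y) →
      (∀ {x} → x ∈ A → ∃[ y ] (y ∈ B × Good x y)) → Bound A B ⊎ CosetIn S₂
    no-Split ∣A∣≥2 ∣B∣≥3 dichotomy some-Good
      with search₂ {P = Single} {Q = Good} Good-resp (elements A) (elements B)
             (λ x∈A y∈B → Sum.swap (dichotomy x∈A y∈B))
         | search₂ (λ x≈ y≈ → ∈-resp-≈ setoid (∙-cong x≈ y≈)) (elements A) (elements B)
             (λ {x} {y} _ _ → ¬P⊎P (x ∙ y ∈? elements S₂))
    ... | inj₂ all-Good | _ = inj₂ (all-Good⇒coset ∣A∣≥2 ∣B∣≥3 all-Good)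
    ... | inj₁ (a , b , a∈A , b∈B , single) | inj₂ popular = inj₁ (all-popular⇒Bound a∈A b∈B single popular)
    -- The Single pairs for this case are found in the row of the unpopular sum.
    ... | inj₁ _ | inj₁ (a , b , a∈A , b∈B , a∙b∉S₂) =
      inj₁ (UnpopularSum.unpopular-sum⇒Bound a∈A b∈B a∙b∉S₂ dichotomy some-Good ∣B∣≥3)

    -- Sets with two elements.

    ∣A∣≤2⇒Bound : ∣ A ∣ ≥ 2 → ∣ A ∣ ≤ 2 → Bound A B
    ∣A∣≤2⇒Bound ∣A∣≥2 ∣A∣≤2 = let a , a′ , a∈A , a′∈A , a≉a′ = two-elements (unique A) ∣A∣≥2 in begin
      2 * ∣ A ∣ + 2 * ∣ B ∣     ≤⟨ ℕ.+-monoˡ-≤ (2 * ∣ B ∣) (ℕ.*-monoʳ-≤ 2 ∣A∣≤2) ⟩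
      4 + 2 * ∣ B ∣             ≡⟨ eq (∣ B ∣) ⟩
      (∣ B ∣ + ∣ B ∣) + 4       ≤⟨ ℕ.+-monoˡ-≤ 4 (two-rows a∈A a′∈A a≉a′) ⟩
      (∣ S₁ ∣ + ∣ S₂ ∣) + 4     ∎
      where
      open ℕ.≤-Reasoning
      eq : ∀ x → 4 + 2 * x ≡ (x + x) + 4
      eq = solve-∀

    ∣B∣≤2⇒Bound : ∣ B ∣ ≥ 2 → ∣ B ∣ ≤ 2 → Bound A B
    ∣B∣≤2⇒Bound ∣B∣≥2 ∣B∣≤2 = let b , b′ , b∈B , b′∈B , b≉b′ = two-elements (unique B) ∣B∣≥2 in begin
      2 * ∣ A ∣ + 2 * ∣ B ∣     ≤⟨ ℕ.+-monoʳ-≤ (2 * ∣ A ∣) (ℕ.*-monoʳ-≤ 2 ∣B∣≤2) ⟩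
      2 * ∣ A ∣ + 4             ≡⟨ eq (∣ A ∣) ⟩
      (∣ A ∣ + ∣ A ∣) + 4       ≤⟨ ℕ.+-monoˡ-≤ 4 (two-columns b∈B b′∈B b≉b′) ⟩
      (∣ S₁ ∣ + ∣ S₂ ∣) + 4     ∎
      where
      open ℕ.≤-Reasoning
      eq : ∀ x → 2 * x + 4 ≡ (x + x) + 4
      eq = solve-∀

  -- The induction.

  -- B counts twice in the measure because the Dyson transform keeps |A| + |B| and only shrinks B.
  -- Both sets keep at least 2 elements: a Split pair leaves 2 in `B⁻`, and an element leaves A only
  -- when |A| ≥ 3.
  Bound⊎CosetIn : ∀ n A B → ∣ A ∣ ≥ 2 → ∣ B ∣ ≥ 2 → (∣ A ∣ + ∣ B ∣) + ∣ B ∣ ≤ n →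
    Bound A B ⊎ CosetIn (A +⟨ 2 ⟩ B)
  Bound⊎CosetIn zero A B ∣A∣≥2 _ size≤0 =
    contradiction (ℕ.≤-trans ∣A∣≥2 (ℕ.≤-trans (ℕ.≤-trans (ℕ.m≤m+n _ _) (ℕ.m≤m+n _ _)) size≤0)) λ ()
  Bound⊎CosetIn (suc n) A B ∣A∣≥2 ∣B∣≥2 size≤1+n with ∣ A ∣ ℕ.≤? 2 | ∣ B ∣ ℕ.≤? 2
  ... | yes ∣A∣≤2 | _ = inj₁ (∣A∣≤2⇒Bound A B ∣A∣≥2 ∣A∣≤2)
  ... | no _ | yes ∣B∣≤2 = inj₁ (∣B∣≤2⇒Bound A B ∣B∣≥2 ∣B∣≤2)
  ... | no ∣A∣≰2 | no ∣B∣≰2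
    with search₂ {P = Split} {Q = λ a b → Good a b ⊎ Single a b}
           (λ a≈ b≈ → Sum.map (Good-resp a≈ b≈) (Single-resp a≈ b≈))
           (elements A) (elements B) (λ {a} {b} _ _ → classify a b)
    where open Sums A B
  ... | inj₁ (a , b , a∈A , b∈B , split) =
    transform (Bound⊎CosetIn n A⁺ B⁻ ∣A⁺∣≥2 (2≤∣B⁻∣ split b∈B a∈A) smaller)
    where
    open DysonTransform A B a b
    ∣A⁺∣≥2 : ∣ A⁺ ∣ ≥ 2
    ∣A⁺∣≥2 = ℕ.≤-trans ∣A∣≥2 (≡.subst (∣ A ∣ ≤_) (≡.sym (length-++ (elements A))) (ℕ.m≤m+n _ _))
    smaller : (∣ A⁺ ∣ + ∣ B⁻ ∣) + ∣ B⁻ ∣ ≤ n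
    smaller = s≤s⁻¹ (ℕ.≤-trans (≡.subst (λ m → m + ∣ B⁻ ∣ < (∣ A ∣ + ∣ B ∣) + ∣ B ∣) (≡.sym ∣A⁺∣+∣B⁻∣)
      (ℕ.+-monoʳ-< (∣ A ∣ + ∣ B ∣) (∣B⁻∣<∣B∣ split b∈B a∈A))) size≤1+n)
  ... | inj₂ dichotomy
    -- Either some a is Single with every b, or each a has a Good partner.
    with search {P = λ a → ∀ {b} → b ∈ B → Single a b} {Q = λ a → ∃[ b ] (b ∈ B × Good a b)}
           (λ a≈ (b , b∈B , good) → b , b∈B , Good-resp a≈ refl good) (elements A)
           (λ {a} a∈A → Sum.swap (search {P = Good a} {Q = Single a} (Single-resp refl) (elements B) (dichotomy a∈A)))
    where open Sums A B
  ... | inj₁ (a , a∈A , single) = remove-Single A B a∈A single ∣B∣≥2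
    (Bound⊎CosetIn n (A ∖ a) B (s≤s⁻¹ (ℕ.≤-trans (ℕ.≰⇒> ∣A∣≰2) (∣A∣≤1+∣A∖b∣ A a))) ∣B∣≥2
      (s≤s⁻¹ (ℕ.≤-trans (ℕ.+-monoˡ-< (∣ B ∣) (ℕ.+-monoˡ-< (∣ B ∣) (∣A∖b∣<∣A∣ A a∈A))) size≤1+n)))
  ... | inj₂ some-Good = no-Split A B ∣A∣≥2 (ℕ.≰⇒> ∣B∣≰2) dichotomy some-Good

-- Singletons are excluded: if |A| = 1 and |B| ≥ 3, then A +₂ B is empty and |A +₁ B| = |B| < 2|B| -
-- 2, so both alternatives fail.
corollary1p3 : ∀ {c ℓ : Level} (G : AbelianGroup c ℓ) (_≟_ : Decidable (AbelianGroup._≈_ G)) →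
    let open PopularSums G _≟_ hiding (_+_) in
    (A B : FinSubset) → ∣ A ∣ ≥ 2 → ∣ B ∣ ≥ 2 →
    (∣ A +⟨ 1 ⟩ B ∣ + ∣ A +⟨ 2 ⟩ B ∣ ≥ 2 * ∣ A ∣ + 2 * ∣ B ∣ ∸ 4)
    ⊎ (∃[ x ] ∃[ H ] (IsSubgroup H × ∣ H ∣ ≥ 3 × x +ᶜ H ⊆ (A +⟨ 2 ⟩ B)))
corollary1p3 G _≟_ A B ∣A∣≥2 ∣B∣≥2 = Sum.map₁
  (λ bound → ℕ.m≤n+o⇒m∸n≤o _ 4 (ℕ.≤-trans bound (ℕ.≤-reflexive (ℕ.+-comm _ 4))))
  (Bound⊎CosetIn G _≟_ _ A B ∣A∣≥2 ∣B∣≥2 ℕ.≤-refl)
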